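{- Let $X_n$ be the number of correct guesses in the card guessing game with complete feedback after a single shelf shuffle of $n$ cards. The bivariate generating function $S(z,v)=\sum_{n\ge 1}\mathbb E(v^{X_n})z^n$ is given by $$S(z,v)=\frac{zv+\dfrac{\frac{z^2v}{2}}{1-\frac{zv}{2}}}{1-\frac{zv}{2}-\dfrac{\frac z2}{1-\frac{zv}{2}}+\frac z2}=\frac{2zv\,\bigl(2+(1-v)z\bigr)}{4-4vz+(v^2-v)z^2}.$$
   Context: Single shelf shuffle: an ordered deck of $n$ cards labelled $1,\dots,n$ (card $1$ on top, card $n$ at the bottom) is given. Cards are drawn one by one from the bottom of the deck (so in the order $n,n-1,\dots,1$) and put on an initially empty pile; each drawn card is placed, independently, at the top or at the bottom of the pile with probability $1/2$ each. The final pile is the shuffled deck. Game: cards are drawn one after the other from the top of the shuffled deck. Before each draw the player guesses the label of the card; afterwards the card is shown (complete feedback). The player uses the following optimal strategy: the first guess is card $1$; as long as neither card $n-1$ nor card $n$ has been shown, the next guess is the label immediately following that of the most recently shown card; once one of the cards $n-1$ or $n$ has been shown, the player guesses the remaining (not yet shown) cards in descending order. $X_n$ denotes the total number of correct guesses. The identity is understood as an identity of formal power series in $z$ with coefficients polynomials in $v$. -}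

module Defs where

open import Algebra.Bundles.Raw using (RawRing)
import Algebra.Definitions.RawSemiring as RawSemiringOps
open import Data.Bool.Base using (if_then_else_)
open import Data.Integer.Base using (+_)
open import Data.List.Base
  using (List; []; _∷_; _++_; _∷ʳ_; map; foldl; foldr; reverse; filter; head; zip; applyUpTo)
open import Data.List.Membership.DecPropositional using (_∈?_; _∉?_)
open import Data.Maybe.Base using (Maybe; just)
open import Data.Maybe.Properties using (≡-dec)
open import Data.Nat.Base as ℕ using (ℕ; zero; suc; _∸_)
open import Data.Nat.Properties using (_≟_)
open import Data.Product.Base using (_,_)
open import Data.Rational.Base as ℚ using (ℚ; 0ℚ; 1ℚ; ½)
open import Data.Vec.Base as Vec using (Vec; []; _∷_; toList)
open import Level using (Level; 0ℓ; _⊔_)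
open import Relation.Binary.PropositionalEquality.Core using (refl)
open import Relation.Nullary.Decidable.Core using (does; _⊎-dec_)

private
  variable
    n : ℕ

-- Polynomials in one indeterminate: lists of coefficients, constant term first.
-- Trailing zeros are allowed, so equality compares all coefficients.

module Polynomial {c ℓ : Level} (R : RawRing c ℓ) where

  private module R = RawRing R

  Poly : Set c
  Poly = List R.Carrier

  coeff : Poly → ℕ → R.Carrier
  coeff []      _       = R.0#
  coeff (a ∷ _) zero    = a
  coeff (_ ∷ p) (suc i) = coeff p i

  add : Poly → Poly → Poly
  add []      q       = q
  add (a ∷ p) []      = a ∷ p
  add (a ∷ p) (b ∷ q) = (a R.+ b) ∷ add p q

  mul : Poly → Poly → Poly
  mul []      q = []
  mul (a ∷ p) q = add (map (a R.*_) q) (R.0# ∷ mul p q)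

  rawRing : RawRing c ℓ
  rawRing = record
    { Carrier = Poly
    ; _≈_     = λ p q → ∀ i → coeff p i R.≈ coeff q i
    ; _+_     = add
    ; _*_     = mul
    ; -_      = map (R.-_)
    ; 0#      = []
    ; 1#      = R.1# ∷ []
    }

  const : R.Carrier → Poly
  const a = a ∷ []

  indeterminate : Poly
  indeterminate = R.0# ∷ R.1# ∷ []

module PowerSeries {c ℓ : Level} (R : RawRing c ℓ) where

  private module R = RawRing R

  Series : Set c
  Series = ℕ → R.Carrier

  const : R.Carrier → Series
  const a zero    = a
  const a (suc _) = R.0#

  indeterminate : Series
  indeterminate zero          = R.0#
  indeterminate (suc zero)    = R.1#
  indeterminate (suc (suc _)) = R.0#

  mul : Series → Series → Series
  mul f g n = foldr R._+_ R.0# (applyUpTo (λ i → f i R.* g (n ∸ i)) (suc n))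

  rawRing : RawRing c ℓ
  rawRing = record
    { Carrier = Series
    ; _≈_     = λ f g → ∀ n → f n R.≈ g n
    ; _+_     = λ f g n → f n R.+ g n
    ; _*_     = mul
    ; -_      = λ f n → R.- f n
    ; 0#      = const R.0#
    ; 1#      = const R.1#
    }

  -- Over a commutative ring, a series is invertible if and only if its constant
  -- term is.

  record IsInvertible (g : Series) : Set (c ⊔ ℓ) where
    field
      g₀⁻¹    : R.Carrier
      inverse : g₀⁻¹ R.* g 0 R.≈ R.1#

  -- The coefficients h n , … , h 0 (in this order) of the inverse h of g, from
  --   h 0 = (g 0)⁻¹   and   h (n + 1) = - (g 0)⁻¹ · Σ_{i ≤ n} g (i + 1) · h (n - i).

  reciprocal↓ : (g : Series) → R.Carrier → (n : ℕ) → Vec R.Carrier (suc n)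
  reciprocal↓ g g₀⁻¹ zero    = g₀⁻¹ ∷ []
  reciprocal↓ g g₀⁻¹ (suc n) =
    (R.- (g₀⁻¹ R.* Vec.foldr _ R._+_ R.0# (Vec.zipWith R._*_ g₁₊ h↓))) ∷ h↓
    where
    h↓  = reciprocal↓ g g₀⁻¹ n
    g₁₊ = Vec.map g (Vec.iterate suc 1 (suc n))

  reciprocal : (g : Series) → IsInvertible g → Series
  reciprocal g inv n = Vec.head (reciprocal↓ g (IsInvertible.g₀⁻¹ inv) n)

  infixl 7 _/_
  _/_ : (f g : Series) → {{IsInvertible g}} → Series
  _/_ f g {{inv}} = mul f (reciprocal g inv)

Card : Set
Card = ℕ

data Side : Set where
  top bottom : Side

-- Decks and piles are listed from top to bottom.

deck : ℕ → List Card
deck n = applyUpTo suc n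

place : List Card → Side → Card → List Card
place pile top    c = c ∷ pile
place pile bottom c = pile ∷ʳ c

-- The i-th entry of ω is the side on which the i-th drawn card is placed.

shuffle : Vec Side n → List Card
shuffle {n} ω =
  foldl (λ pile (s , c) → place pile s c) [] (zip (toList ω) (reverse (deck n)))

-- The guess given the cards shown so far, most recent first; it is `nothing`
-- only when no card is left.  For n = 1 the label n ∸ 1 = 0 is not a card.

guess : ℕ → List Card → Maybe Card
guess n []               = just 1
guess n shown@(last ∷ _) =
  if does (_∈?_ _≟_ (n ∸ 1) shown ⊎-dec _∈?_ _≟_ n shown)
  then head (filter (λ c → _∉?_ _≟_ c shown) (reverse (deck n)))
  else just (suc last)

correctGuesses : ℕ → (shown remaining : List Card) → ℕ
correctGuesses n shown []      = 0
correctGuesses n shown (c ∷ r) =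
  (if does (≡-dec _≟_ (guess n shown) (just c)) then 1 else 0)
    ℕ.+ correctGuesses n (c ∷ shown) r

X : (n : ℕ) → Vec Side n → ℕ
X n ω = correctGuesses n [] (shuffle ω)

module ℚ[v] where
  open Polynomial ℚ.+-*-rawRing public
  open RawRing rawRing public using (_+_; _*_; 0#; rawSemiring)
  open RawSemiringOps rawSemiring public using (_^_)

-- The sample space of n independent fair coin flips, with product measure ℙ.

placements : (n : ℕ) → List (Vec Side n)
placements zero    = [] ∷ []
placements (suc n) = map (top ∷_) (placements n) ++ map (bottom ∷_) (placements n)

ℙ : Vec Side n → ℚ
ℙ []      = 1ℚ
ℙ (_ ∷ ω) = ½ ℚ.* ℙ ω

𝔼 : (Vec Side n → ℚ[v].Poly) → ℚ[v].Poly
𝔼 {n} f = foldr _+_ 0# (map (λ ω → const (ℙ ω) * f ω) (placements n))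
  where open ℚ[v]

open PowerSeries ℚ[v].rawRing public
  using (Series; IsInvertible; _/_)
  renaming (rawRing to ℚ[v]⟦z⟧; indeterminate to z; const to constᶻ)
open RawRing ℚ[v]⟦z⟧ public
  using (_≈_; _+_; _*_; -_; 0#; 1#)
open RawSemiringOps (RawRing.rawSemiring ℚ[v]⟦z⟧) public
  using (_^_) renaming (_×_ to _·_)

infixl 6 _-_
_-_ : Series → Series → Series
f - g = f + (- g)

v : Series
v = constᶻ ℚ[v].indeterminate

half : Series
half = constᶻ (ℚ[v].const ½)

S : Series
S zero      = ℚ[v].0#
S n@(suc _) = 𝔼 (λ ω → ℚ[v].indeterminate ℚ[v].^ X n ω)

instance
  inv₁ : IsInvertible (1# - half * (z * v))
  inv₁ = record
    { g₀⁻¹    = ℚ[v].const 1ℚ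
    ; inverse = λ { 0 → refl ; 1 → refl ; (suc (suc _)) → refl }
    }

  inv₂ : IsInvertible (1# - half * (z * v) - (half * z) / (1# - half * (z * v)) + half * z)
  inv₂ = record
    { g₀⁻¹    = ℚ[v].const 1ℚ
    ; inverse = λ { 0 → refl ; 1 → refl ; (suc (suc _)) → refl }
    }

  inv₃ : IsInvertible (4 · 1# - 4 · (v * z) + (v ^ 2 - v) * z ^ 2)
  inv₃ = record
    { g₀⁻¹    = ℚ[v].const (+ 1 ℚ./ 4)
    ; inverse = λ { 0 → refl ; 1 → refl ; 2 → refl ; (suc (suc (suc _))) → refl }
    }

{-# OPTIONS --safe #-}

-- The shuffled deck consists of the cards placed on top in ascending order, card n,
-- and the cards placed at the bottom in descending order. Mark card i by the side on
-- which it is placed, card n and a fictitious card 0 both counting as top. In the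
-- ascending part a card other than n is guessed right exactly when its predecessor is
-- marked top, card n is guessed right exactly when card n - 1 is, and from then on
-- every guess is right. So X is the number of i in 1 … n for which the marks of i - 1
-- and i are not bottom, top. Let a and b be the generating functions, in the number
-- of random marks, for the highest mark being prescribed as top and bottom. Then
--   a = v + z (v a + b) / 2,   b = v + z (v a + v b) / 2,   S = z a,
-- and eliminating b yields the second fraction.

module Submission where

open import Algebra.Bundles using (CommutativeRing)
open import Algebra.Bundles.Raw using (RawRing)
import Algebra.Consequences.Setoid as Consequences
import Algebra.Construct.Pointwise as Pointwise
import Algebra.Definitions.RawSemiring as RawSemiringOps
import Algebra.Morphism.RingMonomorphism as RingMonomorphism
open import Algebra.Morphism.Structures using (IsRingMonomorphism)
import Algebra.Properties.CommutativeSemigroup as CommutativeSemigroupProperties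
import Algebra.Properties.Group as GroupProperties
import Algebra.Properties.Ring as RingProperties
import Algebra.Solver.Ring as RingSolver
open import Algebra.Solver.Ring.AlmostCommutativeRing
  using (fromCommutativeRing; _-Raw-AlmostCommutative⟶_)
import Data.Integer.Base as ℤ
open import Data.List.Base using (List; []; _∷_; _++_; foldr; map)
open import Data.List.Properties using (map-∘)
import Data.Maybe.Base as Maybe
open import Data.Nat.Base as ℕ using (ℕ; zero; suc)
import Data.Nat.Properties as ℕ
open import Data.Product.Base using (_×_; _,_)
open import Data.Rational.Base as ℚ using (ℚ; 1ℚ; ½)
import Data.Rational.Properties as ℚ
open import Data.Vec.Base as Vec using (Vec; []; _∷_)
open import Function.Base using (_∘_)
open import Level using (0ℓ)
open import Relation.Binary.Bundles using (Setoid)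
import Relation.Binary.PropositionalEquality.Core as ≡
import Relation.Binary.Reasoning.Setoid as SetoidReasoning
open import Relation.Nullary.Decidable using (dec⇒maybe)

open import Defs using (module PowerSeries; module Polynomial)

-- Cauchy products and reciprocals of formal power series.

module PowerSeriesProperties {c ℓ} (R : CommutativeRing c ℓ) where

  open CommutativeRing R hiding (zero)
  open PowerSeries rawRing
    using (Series; const; indeterminate; mul; IsInvertible; reciprocal; reciprocal↓)
    renaming (rawRing to seriesRawRing)
  open CommutativeSemigroupProperties +-commutativeSemigroup
    using () renaming (interchange to +-interchange)
  open RingProperties ring using (-‿distribʳ-*)
  open SetoidReasoning setoid

  infix 4 _≋_
  _≋_ : Series → Series → Set ℓ
  f ≋ g = ∀ n → f n ≈ g n

  mul-cong : ∀ {f f′ g g′} → f ≋ f′ → g ≋ g′ → mul f g ≋ mul f′ g′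
  mul-cong f≋ g≋ zero    = +-congʳ (*-cong (f≋ 0) (g≋ 0))
  -- `mul f g (suc n)` unfolds definitionally to `f 0 * g (suc n) + mul (f ∘ suc) g n`: the left
  -- factor is shifted, the right one kept. The inductions on products follow this recursion.
  mul-cong f≋ g≋ (suc n) =
    +-cong (*-cong (f≋ 0) (g≋ (suc n))) (mul-cong (f≋ ∘ suc) g≋ n)

  mul-congʳ : ∀ {f f′} g → f ≋ f′ → mul f g ≋ mul f′ g
  mul-congʳ g f≋ = mul-cong {g = g} f≋ (λ _ → refl)

  mul-zeroˡ : ∀ {f} g → (∀ n → f n ≈ 0#) → ∀ n → mul f g n ≈ 0#
  mul-zeroˡ g f≈0 zero    =
    trans (+-identityʳ _) (trans (*-congʳ (f≈0 0)) (zeroˡ _))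
  mul-zeroˡ g f≈0 (suc n) =
    trans (+-cong (trans (*-congʳ (f≈0 0)) (zeroˡ _)) (mul-zeroˡ g (f≈0 ∘ suc) n))
          (+-identityʳ _)

  const-mul : ∀ a g n → mul (const a) g n ≈ a * g n
  const-mul a g zero    = +-identityʳ _
  const-mul a g (suc n) = trans (+-congˡ (mul-zeroˡ g (λ _ → refl) n)) (+-identityʳ _)

  indeterminate-mul-zero : ∀ g → mul indeterminate g 0 ≈ 0#
  indeterminate-mul-zero g = trans (+-identityʳ _) (zeroˡ _)

  indeterminate-mul-suc : ∀ g n → mul indeterminate g (suc n) ≈ g n
  indeterminate-mul-suc g n = begin
    0# * g (suc n) + mul (indeterminate ∘ suc) g n ≈⟨ +-congʳ (zeroˡ _) ⟩
    0# + mul (indeterminate ∘ suc) g n             ≈⟨ +-identityˡ _ ⟩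
    mul (indeterminate ∘ suc) g n
      ≈⟨ mul-congʳ {indeterminate ∘ suc} {const 1#} g (λ { zero → refl ; (suc _) → refl }) n ⟩
    mul (const 1#) g n                             ≈⟨ const-mul 1# g n ⟩
    1# * g n                                       ≈⟨ *-identityˡ _ ⟩
    g n                                            ∎

  scale-mul : ∀ a f g n → mul (λ i → a * f i) g n ≈ a * mul f g n
  scale-mul a f g zero    = begin
    a * f 0 * g 0 + 0#     ≈⟨ +-cong (*-assoc _ _ _) (sym (zeroʳ a)) ⟩
    a * (f 0 * g 0) + a * 0# ≈⟨ distribˡ _ _ _ ⟨
    a * (f 0 * g 0 + 0#)   ∎
  scale-mul a f g (suc n) =
    trans (+-cong (*-assoc _ _ _) (scale-mul a (f ∘ suc) g n)) (sym (distribˡ _ _ _))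

  mul-distribʳ : ∀ h f g n → mul (λ i → f i + g i) h n ≈ mul f h n + mul g h n
  mul-distribʳ h f g zero    = begin
    (f 0 + g 0) * h 0 + 0#                ≈⟨ +-cong (distribʳ _ _ _) (sym (+-identityʳ 0#)) ⟩
    (f 0 * h 0 + g 0 * h 0) + (0# + 0#)   ≈⟨ +-interchange _ _ _ _ ⟩
    (f 0 * h 0 + 0#) + (g 0 * h 0 + 0#)   ∎
  mul-distribʳ h f g (suc n) =
    trans (+-cong (distribʳ _ _ _) (mul-distribʳ h (f ∘ suc) (g ∘ suc) n))
          (+-interchange _ _ _ _)

  mul-assoc : ∀ f g h → mul (mul f g) h ≋ mul f (mul g h)
  mul-assoc f g h zero    = +-congʳ (begin
    (f 0 * g 0 + 0#) * h 0   ≈⟨ *-congʳ (+-identityʳ _) ⟩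
    f 0 * g 0 * h 0          ≈⟨ *-assoc _ _ _ ⟩
    f 0 * (g 0 * h 0)        ≈⟨ *-congˡ (+-identityʳ _) ⟨
    f 0 * (g 0 * h 0 + 0#)   ∎)
  mul-assoc f g h (suc n) = begin
    (f 0 * g 0 + 0#) * h (suc n)
      + mul (λ i → f 0 * g (suc i) + mul (f ∘ suc) g i) h n
      ≈⟨ +-cong (trans (*-congʳ (+-identityʳ _)) (*-assoc _ _ _))
                (mul-distribʳ h (λ i → f 0 * g (suc i)) (mul (f ∘ suc) g) n) ⟩
    f 0 * (g 0 * h (suc n))
      + (mul (λ i → f 0 * g (suc i)) h n + mul (mul (f ∘ suc) g) h n)
      ≈⟨ +-congˡ (+-cong (scale-mul (f 0) (g ∘ suc) h n) (mul-assoc (f ∘ suc) g h n)) ⟩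
    f 0 * (g 0 * h (suc n)) + (f 0 * mul (g ∘ suc) h n + mul (f ∘ suc) (mul g h) n)
      ≈⟨ +-assoc _ _ _ ⟨
    f 0 * (g 0 * h (suc n)) + f 0 * mul (g ∘ suc) h n + mul (f ∘ suc) (mul g h) n
      ≈⟨ +-congʳ (distribˡ _ _ _) ⟨
    f 0 * mul g h (suc n) + mul (f ∘ suc) (mul g h) n ∎

  -- The defining recursion splits off the first term of the Cauchy sum. Splitting off the last one
  -- is its mirror image, and comparing the two gives commutativity.
  mul-suc : ∀ f g n → mul f g (suc n) ≈ mul f (g ∘ suc) n + f (suc n) * g 0
  mul-suc f g zero    = +-cong (sym (+-identityʳ _)) (+-identityʳ _)
  mul-suc f g (suc n) =
    trans (+-congˡ (mul-suc (f ∘ suc) g n)) (sym (+-assoc _ _ _))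

  mul-comm : ∀ f g → mul f g ≋ mul g f
  mul-comm f g zero    = +-congʳ (*-comm _ _)
  mul-comm f g (suc n) = begin
    f 0 * g (suc n) + mul (f ∘ suc) g n   ≈⟨ +-cong (*-comm _ _) (mul-comm (f ∘ suc) g n) ⟩
    g (suc n) * f 0 + mul g (f ∘ suc) n   ≈⟨ +-comm _ _ ⟩
    mul g (f ∘ suc) n + g (suc n) * f 0   ≈⟨ mul-suc g f n ⟨
    mul g f (suc n)                       ∎

  const-0 : ∀ n → const 0# n ≈ 0#
  const-0 zero    = refl
  const-0 (suc n) = refl

  seriesSetoid : Setoid _ _
  seriesSetoid = record { isEquivalence = Pointwise.isEquivalence ℕ isEquivalence }

  private
    module Series = Consequences seriesSetoid

    _⊕_ : Series → Series → Series
    (f ⊕ g) n = f n + g n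

    ⊕-cong : ∀ {f f′ g g′} → f ≋ f′ → g ≋ g′ → (f ⊕ g) ≋ (f′ ⊕ g′)
    ⊕-cong f≋ g≋ n = +-cong (f≋ n) (g≋ n)

    ⊕-comm : ∀ f g → (f ⊕ g) ≋ (g ⊕ f)
    ⊕-comm f g n = +-comm (f n) (g n)

  seriesRing : CommutativeRing _ _
  seriesRing = record
    { RawRing seriesRawRing
    ; isCommutativeRing = record
      { isRing = record
        { +-isAbelianGroup = record
          { isGroup = record
            { isMonoid = record
              { isSemigroup = Pointwise.isSemigroup ℕ +-isSemigroup
              ; identity    = Series.comm∧idˡ⇒id {_∙_ = _⊕_} ⊕-comm {const 0#}
                  λ f n → trans (+-congʳ (const-0 n)) (+-identityˡ _)
              }
            ; inverse = Series.comm∧invˡ⇒inv {_∙_ = _⊕_} {λ f n → - f n} {const 0#} ⊕-comm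
                λ f n → trans (-‿inverseˡ _) (sym (const-0 n))
            ; ⁻¹-cong = λ f≋g n → -‿cong (f≋g n)
            }
          ; comm = ⊕-comm
          }
        ; *-cong     = mul-cong
        ; *-assoc    = mul-assoc
        ; *-identity = Series.comm∧idˡ⇒id mul-comm
            λ f n → trans (const-mul 1# f n) (*-identityˡ _)
        ; distrib    = Series.comm∧distrʳ⇒distr {mul} {_⊕_}
            (λ {f} {f′} {g} {g′} → ⊕-cong {f} {f′} {g} {g′}) mul-comm mul-distribʳ
        }
      ; *-comm = mul-comm
      }
    }

  module _ (g : Series) (inv : IsInvertible g) where

    open IsInvertible inv

    private
      h : Series
      h = reciprocal g inv

    -- The offset `k` is general because passing to the tails of both vectors raises the first index
    -- of `g` by one. Only `k = 1` is needed afterwards.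
    Σ-reciprocal : ∀ k n →
      Vec.foldr _ _+_ 0#
        (Vec.zipWith _*_ (Vec.map g (Vec.iterate suc k (suc n))) (reciprocal↓ g g₀⁻¹ n))
      ≈ mul (λ i → g (i ℕ.+ k)) h n
    Σ-reciprocal k zero    = refl
    Σ-reciprocal k (suc n) = +-congˡ (trans (Σ-reciprocal (suc k) n)
      (mul-congʳ h (λ i → reflexive (≡.cong g (ℕ.+-suc i k))) n))

    -- The recursion for the reciprocal chooses each new coefficient so that the leading term of the
    -- product cancels the sum `T` of the other terms.
    mul-reciprocal : mul g h ≋ const 1#
    mul-reciprocal zero    = trans (+-identityʳ _) (trans (*-comm _ _) inverse)
    mul-reciprocal (suc n) = begin
      g 0 * - (g₀⁻¹ * T) + mul (g ∘ suc) h n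
        ≈⟨ +-cong (sym (-‿distribʳ-* _ _)) (sym (trans (Σ-reciprocal 1 n)
             (mul-congʳ h (λ i → reflexive (≡.cong g (ℕ.+-comm i 1))) n))) ⟩
      - (g 0 * (g₀⁻¹ * T)) + T
        ≈⟨ +-congʳ (-‿cong (begin
             g 0 * (g₀⁻¹ * T) ≈⟨ *-assoc _ _ _ ⟨
             g 0 * g₀⁻¹ * T   ≈⟨ *-congʳ (trans (*-comm _ _) inverse) ⟩
             1# * T           ≈⟨ *-identityˡ _ ⟩
             T                ∎)) ⟩
      - T + T ≈⟨ -‿inverseˡ _ ⟩
      0# ∎
      where
      T = Vec.foldr _ _+_ 0#
        (Vec.zipWith _*_ (Vec.map g (Vec.iterate suc 1 (suc n))) (reciprocal↓ g g₀⁻¹ n))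

-- Polynomials as a subring of the power series.

module PolynomialProperties {c ℓ} (R : CommutativeRing c ℓ) where

  open CommutativeRing R hiding (zero)
  open Polynomial rawRing
    using (coeff; add) renaming (mul to mulₚ; rawRing to polyRawRing)
  open PowerSeries rawRing using (mul) renaming (rawRing to seriesRawRing)
  open RingProperties ring using (-0#≈0#)
  open PowerSeriesProperties R using (seriesRing; mul-zeroˡ)

  coeff-add : ∀ p q i → coeff (add p q) i ≈ coeff p i + coeff q i
  coeff-add []      q       i       = sym (+-identityˡ _)
  coeff-add (a ∷ p) []      i       = sym (+-identityʳ _)
  coeff-add (a ∷ p) (b ∷ q) zero    = refl
  coeff-add (a ∷ p) (b ∷ q) (suc i) = coeff-add p q i

  coeff-scale : ∀ a p i → coeff (map (a *_) p) i ≈ a * coeff p i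
  coeff-scale a []      i       = sym (zeroʳ a)
  coeff-scale a (b ∷ p) zero    = refl
  coeff-scale a (b ∷ p) (suc i) = coeff-scale a p i

  coeff-neg : ∀ p i → coeff (map (-_) p) i ≈ - coeff p i
  coeff-neg []      i       = sym -0#≈0#
  coeff-neg (b ∷ p) zero    = refl
  coeff-neg (b ∷ p) (suc i) = coeff-neg p i

  coeff-mul : ∀ p q i → coeff (mulₚ p q) i ≈ mul (coeff p) (coeff q) i
  coeff-mul []      q i       = sym (mul-zeroˡ (coeff q) (λ _ → refl) i)
  coeff-mul (a ∷ p) q zero    =
    trans (coeff-add (map (a *_) q) _ 0) (+-congʳ (coeff-scale a q 0))
  coeff-mul (a ∷ p) q (suc i) =
    trans (coeff-add (map (a *_) q) _ (suc i))
          (+-cong (coeff-scale a q (suc i)) (coeff-mul p q i))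

  -- Equality of polynomials is by definition equality of their coefficient sequences, so
  -- injectivity is immediate and the ring laws are inherited from power series.
  coeff-isRingMonomorphism : IsRingMonomorphism polyRawRing seriesRawRing coeff
  coeff-isRingMonomorphism = record
    { isRingHomomorphism = record
      { isSemiringHomomorphism = record
        { isNearSemiringHomomorphism = record
          { +-isMonoidHomomorphism = record
            { isMagmaHomomorphism = record
              { isRelHomomorphism = record { cong = λ p≈q → p≈q }
              ; homo              = coeff-add
              }
            ; ε-homo = λ { zero → refl ; (suc _) → refl }
            }
          ; *-homo = coeff-mul
          }
        ; 1#-homo = λ { zero → refl ; (suc _) → refl }
        }
      ; -‿homo = coeff-neg
      }
    ; injective = λ p≈q → p≈q
    }

  polyRing : CommutativeRing c ℓ
  polyRing = record
    { RawRing polyRawRing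
    ; isCommutativeRing = RingMonomorphism.isCommutativeRing coeff-isRingMonomorphism
        (CommutativeRing.isCommutativeRing seriesRing)
    }

-- The card game: composition of the shuffled deck and number of correct guesses.

module CardGame where

  open import Algebra.Properties.CommutativeSemigroup ℕ.+-commutativeSemigroup
    using (x∙yz≈y∙xz; xy∙z≈xz∙y)
  open import Data.Bool.Base using (if_then_else_; true; false)
  open import Data.Empty using (⊥-elim)
  open import Data.List.Base
    using (List; []; _∷_; _++_; _∷ʳ_; _ʳ++_; applyDownFrom; filter; foldl; head;
           length; reverse; zip)
  open import Data.List.Membership.DecPropositional using (_∈?_; _∉?_)
  open import Data.List.Membership.Propositional using (_∈_; _∉_)
  open import Data.List.Properties
    using (++-identityʳ; ∷ʳ-++; filter-accept; filter-reject; reverse-applyUpTo;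
           reverse-involutive; unfold-reverse)
  open import Data.List.Relation.Unary.All as All using (All; []; _∷_)
  open import Data.List.Relation.Unary.Any using (here; there)
  open import Data.Maybe.Base using (just)
  import Data.Maybe.Properties as Maybe
  open import Data.Nat.Base using (_∸_; _+_; _≤_; _<_; s≤s; s≤s⁻¹)
  open import Data.Nat.Properties using (_≟_)
  open import Data.Product.Base using (_,_)
  open import Data.Sum.Base using (_⊎_; inj₁; inj₂; [_,_])
  open import Data.Vec.Base using ([]; _∷_; toList)
  open import Relation.Binary.PropositionalEquality
    using (_≡_; _≢_; refl; sym; trans; cong; cong₂; module ≡-Reasoning)
  open import Relation.Nullary using (¬_)
  open import Relation.Nullary.Decidable using (does; dec-true; dec-false; _⊎-dec_)
  open import Relation.Unary using (Pred; Decidable)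
  open import Defs
    using (Card; Side; top; bottom; deck; place; shuffle; guess; correctGuesses; X)

  private
    variable
      k n : ℕ

  -- Cards are drawn from the highest down, so the head of a vector of length `suc k` belongs to
  -- card `suc k`. Both lists descend; `tops↓` thus has the form of a list of shown cards, most
  -- recent first.
  tops↓ bottoms : Vec Side k → List Card
  tops↓ []                   = []
  tops↓ {suc k} (top    ∷ ω) = suc k ∷ tops↓ ω
  tops↓         (bottom ∷ ω) = tops↓ ω
  bottoms []                   = []
  bottoms         (top    ∷ ω) = bottoms ω
  bottoms {suc k} (bottom ∷ ω) = suc k ∷ bottoms ω

  placeAll : List Card → Vec Side k → List Card
  placeAll {k} pile ω =
    foldl (λ pile (s , c) → place pile s c) pile (zip (toList ω) (reverse (deck k)))

  placeAll-∷ : ∀ pile s (ω : Vec Side k) →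
    placeAll pile (s ∷ ω) ≡ placeAll (place pile s (suc k)) ω
  placeAll-∷ {k} pile s ω
    rewrite reverse-applyUpTo suc (suc k) | reverse-applyUpTo suc k = refl

  -- The pile present at the start stays in the middle. Later, smaller cards go to its outside,
  -- which makes the part above it ascend and the part below it descend.
  placeAll≡ : ∀ pile (ω : Vec Side k) → placeAll pile ω ≡ reverse (tops↓ ω) ++ pile ++ bottoms ω
  placeAll≡ pile [] = sym (++-identityʳ pile)
  placeAll≡ {suc k} pile (top ∷ ω) = begin
    placeAll pile (top ∷ ω)                              ≡⟨ placeAll-∷ pile top ω ⟩
    placeAll (suc k ∷ pile) ω                            ≡⟨ placeAll≡ (suc k ∷ pile) ω ⟩
    reverse (tops↓ ω) ++ suc k ∷ pile ++ bottoms ω       ≡⟨ ∷ʳ-++ (reverse (tops↓ ω)) _ _ ⟨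
    (reverse (tops↓ ω) ∷ʳ suc k) ++ pile ++ bottoms ω
      ≡⟨ cong (_++ (pile ++ bottoms ω)) (unfold-reverse (suc k) (tops↓ ω)) ⟨
    reverse (suc k ∷ tops↓ ω) ++ pile ++ bottoms ω       ∎
    where open ≡-Reasoning
  placeAll≡ {suc k} pile (bottom ∷ ω) = begin
    placeAll pile (bottom ∷ ω)                           ≡⟨ placeAll-∷ pile bottom ω ⟩
    placeAll (pile ∷ʳ suc k) ω                           ≡⟨ placeAll≡ (pile ∷ʳ suc k) ω ⟩
    reverse (tops↓ ω) ++ (pile ∷ʳ suc k) ++ bottoms ω
      ≡⟨ cong (reverse (tops↓ ω) ++_) (∷ʳ-++ pile _ _) ⟩
    reverse (tops↓ ω) ++ pile ++ suc k ∷ bottoms ω       ∎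
    where open ≡-Reasoning

  -- The highest card meets an empty pile, so its side `s` has no effect.
  shuffle≡ : ∀ s (ω : Vec Side k) → shuffle (s ∷ ω) ≡ reverse (tops↓ ω) ++ suc k ∷ bottoms ω
  shuffle≡ {k} s ω = begin
    placeAll [] (s ∷ ω)                   ≡⟨ placeAll-∷ [] s ω ⟩
    placeAll (place [] s (suc k)) ω       ≡⟨ cong (λ pile → placeAll pile ω) (single s) ⟩
    placeAll (suc k ∷ []) ω               ≡⟨ placeAll≡ (suc k ∷ []) ω ⟩
    reverse (tops↓ ω) ++ suc k ∷ bottoms ω ∎
    where
    open ≡-Reasoning
    single : ∀ s → place [] s (suc k) ≡ suc k ∷ []
    single top    = refl
    single bottom = refl

  tops↓≤ : (ω : Vec Side k) → All (_≤ k) (tops↓ ω)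
  tops↓≤ []           = []
  tops↓≤ (top    ∷ ω) = ℕ.≤-refl ∷ All.map ℕ.m≤n⇒m≤1+n (tops↓≤ ω)
  tops↓≤ (bottom ∷ ω) = All.map ℕ.m≤n⇒m≤1+n (tops↓≤ ω)

  -- The guesses in the two phases of the strategy.

  All<⇒∉ : ∀ {xs} → All (_< n) xs → n ∉ xs
  All<⇒∉ xs<n n∈xs = ℕ.<-irrefl refl (All.lookup xs<n n∈xs)

  head-filter-applyDownFrom : ∀ {p} {P : Pred ℕ p} (P? : Decidable P) {c} →
    P (suc c) → c < n → (∀ {j} → suc c < j → j ≤ n → ¬ P j) →
    head (filter P? (applyDownFrom suc n)) ≡ just (suc c)
  head-filter-applyDownFrom {suc n} P? Pc c<n none with ℕ.m≤n⇒m<n∨m≡n c<n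
  ... | inj₂ refl = cong head (filter-accept P? Pc)
  ... | inj₁ c<n′ = trans (cong head (filter-reject P? (none c<n′ ℕ.≤-refl)))
    (head-filter-applyDownFrom P? Pc (s≤s⁻¹ c<n′) (λ c<j → none c<j ∘ ℕ.m≤n⇒m≤1+n))

  if-true : ∀ {a} {A : Set a} {b} {x y : A} → b ≡ true → (if b then x else y) ≡ x
  if-true refl = refl

  if-false : ∀ {a} {A : Set a} {b} {x y : A} → b ≡ false → (if b then x else y) ≡ y
  if-false refl = refl

  guess-following : ∀ n {l s} → All (_< n ∸ 1) (l ∷ s) → guess n (l ∷ s) ≡ just (suc l)
  guess-following n {l} {s} small = if-false
    (dec-false (_∈?_ _≟_ (n ∸ 1) (l ∷ s) ⊎-dec _∈?_ _≟_ n (l ∷ s))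
      [ All<⇒∉ small
      , All<⇒∉ (All.map (λ x<n-1 → ℕ.<-≤-trans x<n-1 (ℕ.m∸n≤m n 1)) small) ])

  -- All labels above `suc c` are shown, so in descending order `suc c` is the first to pass the
  -- filter.
  guess-descending : ∀ {s c} → n ∸ 1 ∈ s ⊎ n ∈ s →
    suc c ∉ s → c < n → (∀ {j} → suc c < j → j ≤ n → j ∈ s) → guess n s ≡ just (suc c)
  guess-descending {s = []} (inj₁ ())
  guess-descending {s = []} (inj₂ ())
  guess-descending {n} {s@(_ ∷ _)} {c} shown c∉s c<n above = begin
    guess n s
      ≡⟨ if-true (dec-true (_∈?_ _≟_ (n ∸ 1) s ⊎-dec _∈?_ _≟_ n s) shown) ⟩
    head (filter (λ c → _∉?_ _≟_ c s) (reverse (deck n)))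
      ≡⟨ cong (head ∘ filter _) (reverse-applyUpTo suc n) ⟩
    head (filter (λ c → _∉?_ _≟_ c s) (applyDownFrom suc n))
      ≡⟨ head-filter-applyDownFrom (λ c → _∉?_ _≟_ c s) c∉s c<n
           (λ c<j j≤n j∉s → j∉s (above c<j j≤n)) ⟩
    just (suc c) ∎
    where open ≡-Reasoning

  score : ℕ → List Card → Card → ℕ
  score n s c = if does (Maybe.≡-dec _≟_ (guess n s) (just c)) then 1 else 0

  score-hit : ∀ n s {c} → guess n s ≡ just c → score n s c ≡ 1
  score-hit n s eq = if-true (dec-true (Maybe.≡-dec _≟_ _ _) eq)

  score-miss : ∀ n s {c} → guess n s ≢ just c → score n s c ≡ 0
  score-miss n s neq = if-false (dec-false (Maybe.≡-dec _≟_ _ _) neq)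

  -- The marks of two consecutive labels, the smaller label first. The value 0 belongs to a card of
  -- the ascending part whose predecessor is missing there, which is the only kind of wrong guess.
  nonAscent : Side → Side → ℕ
  nonAscent bottom top = 0
  nonAscent _      _   = 1

  -- The label 0 is treated as a card placed at the top, in accordance with the first
  -- guess.
  latest : Vec Side k → Side
  latest []      = top
  latest (s ∷ _) = s

  nonAscents : Vec Side k → ℕ
  nonAscents []      = 0
  nonAscents (s ∷ ω) = nonAscent (latest ω) s + nonAscents ω

  -- Correct guesses as non-ascents of the marks.

  tops↓< : (ω : Vec Side k) → k < n → All (_< n) (tops↓ ω)
  tops↓< ω k<n = All.map (λ x≤k → ℕ.≤-<-trans x≤k k<n) (tops↓≤ ω)

  -- A predecessor marked top has just been shown, and either phase then guesses its successor. If
  -- the predecessor is marked bottom, the last shown card is smaller still and the guess is too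
  -- low. For card 1 the fixed first guess is right.
  score-next : (ω : Vec Side k) → k < n → score n (tops↓ ω) (suc k) ≡ nonAscent (latest ω) top
  score-next [] _ = refl
  score-next {suc k} {suc n} (top ∷ ω) k<n with ℕ.m≤n⇒m<n∨m≡n (s≤s⁻¹ k<n)
  ... | inj₁ k<n-1 =
    score-hit (suc n) (tops↓ (top ∷ ω)) (guess-following (suc n) (tops↓< (top ∷ ω) k<n-1))
  -- The predecessor `suc k` is the last label but one. Showing it starts the descending phase,
  -- whose first guess is the highest card.
  ... | inj₂ refl  = score-hit (suc n) (tops↓ (top ∷ ω)) (guess-descending (inj₁ (here refl))
    (All<⇒∉ (tops↓< (top ∷ ω) k<n)) ℕ.≤-refl
    (λ c<j j≤n → ⊥-elim (ℕ.<-irrefl refl (ℕ.<-≤-trans c<j j≤n))))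
  score-next {suc k} {suc n} (bottom ∷ ω) k<n = score-miss (suc n) (tops↓ ω) miss
    where
    miss : guess (suc n) (tops↓ ω) ≢ just (suc (suc k))
    -- With nothing shown the guess is 1; otherwise the last shown card `l` is at most `k`, so the
    -- guess `suc l` is below `suc (suc k)`.
    miss with tops↓ ω | tops↓≤ ω | tops↓< ω (s≤s⁻¹ k<n)
    ... | []    | _       | _     = λ ()
    ... | l ∷ s | l≤k ∷ _ | small = λ eq →
      ℕ.<-irrefl
        (ℕ.suc-injective (Maybe.just-injective
          (trans (sym (guess-following (suc n) small)) eq)))
        (s≤s l≤k)

  correctGuesses-++ : ∀ n s xs ys →
    correctGuesses n s (xs ++ ys) ≡ correctGuesses n s xs + correctGuesses n (xs ʳ++ s) ys
  correctGuesses-++ n s []       ys = refl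
  correctGuesses-++ n s (x ∷ xs) ys =
    trans (cong (score n s x +_) (correctGuesses-++ n (x ∷ s) xs ys))
          (sym (ℕ.+-assoc (score n s x) _ _))

  -- Cards placed at the bottom are credited here with one point each, although they are dealt
  -- later. Each of them is a non-ascent, so the induction can run through the labels in order.
  correctGuesses-tops : (ω : Vec Side k) → k < n →
    correctGuesses n [] (reverse (tops↓ ω)) + length (bottoms ω) ≡ nonAscents ω
  correctGuesses-tops [] _ = refl
  correctGuesses-tops {suc k} {n} (top ∷ ω) k<n = begin
    correctGuesses n [] (reverse (suc k ∷ tops↓ ω)) + b
      ≡⟨ cong (λ xs → correctGuesses n [] xs + b) (unfold-reverse (suc k) (tops↓ ω)) ⟩
    correctGuesses n [] (reverse (tops↓ ω) ∷ʳ suc k) + b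
      ≡⟨ cong (_+ b) (correctGuesses-++ n [] (reverse (tops↓ ω)) (suc k ∷ [])) ⟩
    t + (score n (reverse (tops↓ ω) ʳ++ []) (suc k) + 0) + b
      ≡⟨ cong (λ s → t + s + b) (trans (ℕ.+-identityʳ _)
           (trans (cong (λ s → score n s (suc k)) (reverse-involutive (tops↓ ω)))
                  (score-next ω (ℕ.<⇒≤ k<n)))) ⟩
    t + nonAscent (latest ω) top + b
      ≡⟨ trans (xy∙z≈xz∙y t _ b) (ℕ.+-comm (t + b) _) ⟩
    nonAscent (latest ω) top + (t + b)
      ≡⟨ cong (nonAscent (latest ω) top +_) (correctGuesses-tops ω (ℕ.<⇒≤ k<n)) ⟩
    nonAscents (top ∷ ω) ∎
    where
    open ≡-Reasoning
    b = length (bottoms ω)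
    t = correctGuesses n [] (reverse (tops↓ ω))
  correctGuesses-tops {suc k} {n} (bottom ∷ ω) k<n = begin
    t + suc (length (bottoms ω))        ≡⟨ ℕ.+-suc t _ ⟩
    1 + (t + length (bottoms ω))        ≡⟨ cong suc (correctGuesses-tops ω (ℕ.<⇒≤ k<n)) ⟩
    1 + nonAscents ω                    ≡⟨ cong (_+ nonAscents ω) (nonAscent-bottom (latest ω)) ⟨
    nonAscents (bottom ∷ ω)             ∎
    where
    open ≡-Reasoning
    t = correctGuesses n [] (reverse (tops↓ ω))
    nonAscent-bottom : ∀ s → nonAscent s bottom ≡ 1
    nonAscent-bottom top    = refl
    nonAscent-bottom bottom = refl

  -- The hypotheses form an invariant: all labels from `suc k` to `n` are shown, and of the labels
  -- up to `k` exactly those in `tops↓ ω`. As `n` is shown, the highest remaining card is guessed,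
  -- and this is the next one in `bottoms ω`.
  correctGuesses-bottoms : ∀ {s} (ω : Vec Side k) → k < n →
    (∀ {j} → k < j → j ≤ n → j ∈ s) →
    (∀ {j} → j ≤ k → j ∈ s → j ∈ tops↓ ω) →
    (∀ {j} → j ∈ tops↓ ω → j ∈ s) →
    correctGuesses n s (bottoms ω) ≡ length (bottoms ω)
  correctGuesses-bottoms [] _ _ _ _ = refl
  correctGuesses-bottoms {suc k} {n} {s} (top ∷ ω) k<n above below tops⊆ =
    correctGuesses-bottoms ω (ℕ.<⇒≤ k<n) above′ below′ (tops⊆ ∘ there)
    where
    above′ : ∀ {j} → k < j → j ≤ n → j ∈ s
    above′ k<j j≤n with ℕ.m≤n⇒m<n∨m≡n k<j
    ... | inj₁ k<j′ = above k<j′ j≤n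
    ... | inj₂ refl = tops⊆ (here refl)
    below′ : ∀ {j} → j ≤ k → j ∈ s → j ∈ tops↓ ω
    below′ j≤k j∈s with below (ℕ.m≤n⇒m≤1+n j≤k) j∈s
    ... | here refl = ⊥-elim (ℕ.<-irrefl refl j≤k)
    ... | there j∈ω = j∈ω
  correctGuesses-bottoms {suc k} {n} {s} (bottom ∷ ω) k<n above below tops⊆ = cong₂ _+_
    (score-hit n s (guess-descending (inj₂ (above k<n ℕ.≤-refl))
      (λ k∈s → All<⇒∉ (tops↓< ω ℕ.≤-refl) (below ℕ.≤-refl k∈s)) (ℕ.<⇒≤ k<n) above))
    (correctGuesses-bottoms ω (ℕ.<⇒≤ k<n) above′ below′ (there ∘ tops⊆))
    where
    above′ : ∀ {j} → k < j → j ≤ n → j ∈ suc k ∷ s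
    above′ k<j j≤n with ℕ.m≤n⇒m<n∨m≡n k<j
    ... | inj₁ k<j′ = there (above k<j′ j≤n)
    ... | inj₂ refl = here refl
    below′ : ∀ {j} → j ≤ k → j ∈ suc k ∷ s → j ∈ tops↓ ω
    below′ j≤k (here refl)  = ⊥-elim (ℕ.<-irrefl refl j≤k)
    below′ j≤k (there j∈s)  = below (ℕ.m≤n⇒m≤1+n j≤k) j∈s

  -- The highest card follows the ascending part and is scored like one more card of it. Hence its
  -- mark counts as `top` whatever `s` is.
  X≡nonAscents : ∀ s (ω : Vec Side k) → X (suc k) (s ∷ ω) ≡ nonAscents (top ∷ ω)
  X≡nonAscents {k} s ω = begin
    correctGuesses n′ [] (shuffle (s ∷ ω))
      ≡⟨ cong (correctGuesses n′ []) (shuffle≡ s ω) ⟩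
    correctGuesses n′ [] (reverse (tops↓ ω) ++ n′ ∷ bottoms ω)
      ≡⟨ correctGuesses-++ n′ [] (reverse (tops↓ ω)) (n′ ∷ bottoms ω) ⟩
    t + correctGuesses n′ (reverse (tops↓ ω) ʳ++ []) (n′ ∷ bottoms ω)
      ≡⟨ cong (λ shown → t + correctGuesses n′ shown (n′ ∷ bottoms ω))
              (reverse-involutive (tops↓ ω)) ⟩
    t + (score n′ (tops↓ ω) n′ + correctGuesses n′ (n′ ∷ tops↓ ω) (bottoms ω))
      ≡⟨ cong (t +_) (cong₂ _+_ (score-next ω ℕ.≤-refl)
           (correctGuesses-bottoms ω ℕ.≤-refl
             (λ k<j j≤n → here (ℕ.≤-antisym j≤n k<j)) below there)) ⟩
    t + (nonAscent (latest ω) top + length (bottoms ω))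
      ≡⟨ x∙yz≈y∙xz t (nonAscent (latest ω) top) _ ⟩
    nonAscent (latest ω) top + (t + length (bottoms ω))
      ≡⟨ cong (nonAscent (latest ω) top +_) (correctGuesses-tops ω ℕ.≤-refl) ⟩
    nonAscents (top ∷ ω) ∎
    where
    open ≡-Reasoning
    n′ = suc k
    t = correctGuesses n′ [] (reverse (tops↓ ω))
    below : ∀ {j} → j ≤ k → j ∈ n′ ∷ tops↓ ω → j ∈ tops↓ ω
    below j≤k (here refl) = ⊥-elim (ℕ.<-irrefl refl j≤k)
    below j≤k (there j∈ω) = j∈ω

-- Identities between the fractions, over a commutative ring with a map from the rationals.

module RationalAlgebra {c ℓ} (R : CommutativeRing c ℓ)
  (ι : ℚ.+-*-rawRing -Raw-AlmostCommutative⟶ fromCommutativeRing R) where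

  open CommutativeRing R
  open RawSemiringOps (RawRing.rawSemiring rawRing) using (_^_) renaming (_×_ to _·_)
  open _-Raw-AlmostCommutative⟶_ ι using (⟦_⟧)
  open SetoidReasoning setoid
  open GroupProperties +-group using (x≈y⇒x∙y⁻¹≈ε)
  open RingSolver ℚ.+-*-rawRing (fromCommutativeRing R) ι
    (λ p q → Maybe.map (λ p≡q → reflexive (≡.cong ⟦_⟧ p≡q)) (dec⇒maybe (p ℚ.≟ q)))
    using (Polynomial; solve; _:=_; con; _:+_; _:*_; _:-_; _:^_)

  ≈-quotient : ∀ {a c d d⁻¹} → d * d⁻¹ ≈ 1# → a * d ≈ c → a ≈ c * d⁻¹
  ≈-quotient {a} {c} {d} {d⁻¹} dd⁻¹≈1 ad≈c = begin
    a              ≈⟨ *-identityʳ a ⟨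
    a * 1#         ≈⟨ *-congˡ dd⁻¹≈1 ⟨
    a * (d * d⁻¹)  ≈⟨ *-assoc a d d⁻¹ ⟨
    a * d * d⁻¹    ≈⟨ *-congʳ ad≈c ⟩
    c * d⁻¹        ∎

  private
    2ℚ 4ℚ : ℚ
    2ℚ = ℤ.+ 2 ℚ./ 1
    4ℚ = ℤ.+ 4 ℚ./ 1

    h : Carrier
    h = ⟦ ½ ⟧

    :h :1 :2 :4 : ∀ {n} → Polynomial n
    :h = con ½
    -- con 1ℚ denotes ⟦ 1ℚ ⟧, which need not be 1# definitionally.
    :1 = con 1ℚ :^ 0
    :2 = con 2ℚ
    :4 = con 4ℚ

  2·≈ : ∀ x → 2 · x ≈ ⟦ 2ℚ ⟧ * x
  -- `2 · x` unfolds to `x + (x + 0#)`. The variable `o` stands for `0#`, which need not be `⟦ 0ℚ ⟧`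
  -- definitionally.
  2·≈ x = trans (solve 2 (λ x o → x :+ (x :+ o) := :2 :* x :+ o) refl x 0#) (+-identityʳ _)

  4·≈ : ∀ x → 4 · x ≈ ⟦ 4ℚ ⟧ * x
  4·≈ x = trans (solve 2 (λ x o → x :+ (x :+ (x :+ (x :+ o))) := :4 :* x :+ o) refl x 0#)
                (+-identityʳ _)

  module _ (z v : Carrier) where

    geo : Carrier
    geo = 1# - h * (z * v)

    -- The parts of the first fraction, as functions of an inverse of `geo`; the primed versions
    -- below belong to the second fraction.
    numerator denominator : Carrier → Carrier
    numerator   geo⁻¹ = z * v + (h * (z ^ 2 * v)) * geo⁻¹
    denominator geo⁻¹ = geo - (h * z) * geo⁻¹ + h * z

    numerator′ denominator′ : Carrier
    numerator′   = 2 · (z * v) * (2 · 1# + (1# - v) * z)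
    denominator′ = 4 · 1# - 4 · (v * z) + (v ^ 2 - v) * z ^ 2

    numerator′≈ : numerator′ ≈ ⟦ 2ℚ ⟧ * (z * v) * (⟦ 2ℚ ⟧ * 1# + (1# - v) * z)
    numerator′≈ = *-cong (2·≈ _) (+-congʳ (2·≈ _))

    denominator′≈ : denominator′ ≈ ⟦ 4ℚ ⟧ * 1# - ⟦ 4ℚ ⟧ * (v * z) + (v ^ 2 - v) * z ^ 2
    denominator′≈ = +-congʳ (+-cong (4·≈ _) (-‿cong (4·≈ _)))

    -- The factor `geo` clears the inner fraction and 4 clears the halves. The solver first gathers
    -- the product of `geo` and its inverse, which is then replaced by 1.
    numerator-expand : ∀ {geo⁻¹} → geo * geo⁻¹ ≈ 1# →
      ⟦ 4ℚ ⟧ * geo * numerator geo⁻¹ ≈ numerator′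
    numerator-expand {i} gi≈1 = begin
      ⟦ 4ℚ ⟧ * geo * numerator i
        ≈⟨ solve 3 (λ z v i → let g = :1 :- :h :* (z :* v) in
             :4 :* g :* (z :* v :+ (:h :* (z :^ 2 :* v)) :* i)
             := :4 :* (g :* (z :* v) :+ :h :* (z :^ 2 :* v) :* (g :* i))) refl z v i ⟩
      ⟦ 4ℚ ⟧ * (geo * (z * v) + h * (z ^ 2 * v) * (geo * i))
        ≈⟨ *-congˡ (+-congˡ (*-congˡ gi≈1)) ⟩
      ⟦ 4ℚ ⟧ * (geo * (z * v) + h * (z ^ 2 * v) * 1#)
        ≈⟨ solve 2 (λ z v → :4 :* ((:1 :- :h :* (z :* v)) :* (z :* v) :+ :h :* (z :^ 2 :* v) :* :1)
             := :2 :* (z :* v) :* (:2 :* :1 :+ (:1 :- v) :* z)) refl z v ⟩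
      _ ≈⟨ numerator′≈ ⟨
      numerator′ ∎

    denominator-expand : ∀ {geo⁻¹} → geo * geo⁻¹ ≈ 1# →
      ⟦ 4ℚ ⟧ * geo * denominator geo⁻¹ ≈ denominator′
    denominator-expand {i} gi≈1 = begin
      ⟦ 4ℚ ⟧ * geo * denominator i
        ≈⟨ solve 3 (λ z v i → let g = :1 :- :h :* (z :* v) in
             :4 :* g :* (g :- (:h :* z) :* i :+ :h :* z)
             := :4 :* (g :* g :- :h :* z :* (g :* i) :+ g :* (:h :* z))) refl z v i ⟩
      ⟦ 4ℚ ⟧ * (geo * geo - h * z * (geo * i) + geo * (h * z))
        ≈⟨ *-congˡ (+-congʳ (+-congˡ (-‿cong (*-congˡ gi≈1)))) ⟩
      ⟦ 4ℚ ⟧ * (geo * geo - h * z * 1# + geo * (h * z))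
        ≈⟨ solve 2 (λ z v → let g = :1 :- :h :* (z :* v) in
             :4 :* (g :* g :- :h :* z :* :1 :+ g :* (:h :* z))
             := :4 :* :1 :- :4 :* (v :* z) :+ (v :^ 2 :- v) :* z :^ 2) refl z v ⟩
      _ ≈⟨ denominator′≈ ⟨
      denominator′ ∎

    -- The second fraction is the first one expanded by `⟦ 4ℚ ⟧ * geo`.
    fractions-equal : ∀ {geo⁻¹ d⁻¹ d′⁻¹} → geo * geo⁻¹ ≈ 1# →
      denominator geo⁻¹ * d⁻¹ ≈ 1# → denominator′ * d′⁻¹ ≈ 1# →
      numerator geo⁻¹ * d⁻¹ ≈ numerator′ * d′⁻¹
    fractions-equal {i} {j} gi≈1 dd⁻¹≈1 d′d′⁻¹≈1 = ≈-quotient d′d′⁻¹≈1 (begin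
      numerator i * j * denominator′ ≈⟨ *-congˡ (denominator-expand gi≈1) ⟨
      numerator i * j * (⟦ 4ℚ ⟧ * geo * denominator i)
        ≈⟨ solve 4 (λ n j g d → n :* j :* (g :* d) := g :* n :* (d :* j)) refl _ _ _ _ ⟩
      ⟦ 4ℚ ⟧ * geo * numerator i * (denominator i * j)
        ≈⟨ *-cong (numerator-expand gi≈1) dd⁻¹≈1 ⟩
      numerator′ * 1# ≈⟨ *-identityʳ _ ⟩
      numerator′ ∎)

    -- Cramer's rule: add geo times the first equation to h * z times the second.
    linear-system : ∀ {a b} →
      a ≈ v + z * (h * (v * a + b)) → b ≈ v + z * (h * (v * a + v * b)) →
      z * a * denominator′ ≈ numerator′
    linear-system {a} {b} eqᵃ eqᵇ = begin
      z * a * denominator′ ≈⟨ *-congˡ denominator′≈ ⟩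
      z * a * (⟦ 4ℚ ⟧ * 1# - ⟦ 4ℚ ⟧ * (v * z) + (v ^ 2 - v) * z ^ 2)
        ≈⟨ solve 4 (λ z v a b →
             z :* a :* (:4 :* :1 :- :4 :* (v :* z) :+ (v :^ 2 :- v) :* z :^ 2)
             := :2 :* (z :* v) :* (:2 :* :1 :+ (:1 :- v) :* z)
                :+ :4 :* z :* ((:1 :- :h :* (z :* v)) :* (a :- (v :+ z :* (:h :* (v :* a :+ b))))
                            :+ :h :* z :* (b :- (v :+ z :* (:h :* (v :* a :+ v :* b))))))
             refl z v a b ⟩
      _ + ⟦ 4ℚ ⟧ * z * (geo * (a - _) + h * z * (b - _))
        ≈⟨ +-congˡ (*-congˡ (+-cong (*-congˡ (x≈y⇒x∙y⁻¹≈ε eqᵃ)) (*-congˡ (x≈y⇒x∙y⁻¹≈ε eqᵇ)))) ⟩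
      _ + ⟦ 4ℚ ⟧ * z * (geo * 0# + h * z * 0#)
        ≈⟨ +-congˡ (trans (*-congˡ (trans (+-cong (zeroʳ _) (zeroʳ _)) (+-identityʳ _))) (zeroʳ _)) ⟩
      _ + 0# ≈⟨ +-identityʳ _ ⟩
      _ ≈⟨ numerator′≈ ⟨
      numerator′ ∎

-- Expectations over coin flips and their recursions.

module Expectation {c ℓ} (R : CommutativeRing c ℓ)
  (ι : ℚ.+-*-rawRing -Raw-AlmostCommutative⟶ fromCommutativeRing R) where

  open CommutativeRing R hiding (zero)
  open RawSemiringOps (RawRing.rawSemiring rawRing) using (_^_)
  open _-Raw-AlmostCommutative⟶_ ι using (⟦_⟧; +-homo; *-homo; -‿homo; 0-homo; 1-homo)
  open RingProperties ring using (-0#≈0#)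
  open CommutativeSemigroupProperties *-commutativeSemigroup using (x∙yz≈y∙xz)
  open SetoidReasoning setoid
  open import Defs using (Side; top; bottom; placements; ℙ; X)
  open CardGame using (nonAscents; X≡nonAscents)

  Σ : ∀ {a} {A : Set a} → List A → (A → Carrier) → Carrier
  Σ xs f = foldr _+_ 0# (map f xs)

  Σ-cong : ∀ {a} {A : Set a} (xs : List A) {f g} → (∀ x → f x ≈ g x) → Σ xs f ≈ Σ xs g
  Σ-cong []       f≈g = refl
  Σ-cong (x ∷ xs) f≈g = +-cong (f≈g x) (Σ-cong xs f≈g)

  Σ-++ : ∀ {a} {A : Set a} (xs ys : List A) f → Σ (xs ++ ys) f ≈ Σ xs f + Σ ys f
  Σ-++ []       ys f = sym (+-identityˡ _)
  Σ-++ (x ∷ xs) ys f = trans (+-congˡ (Σ-++ xs ys f)) (sym (+-assoc _ _ _))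

  Σ-*ˡ : ∀ {a} {A : Set a} (xs : List A) p f → Σ xs (λ x → p * f x) ≈ p * Σ xs f
  Σ-*ˡ []       p f = sym (zeroʳ p)
  Σ-*ˡ (x ∷ xs) p f = trans (+-congˡ (Σ-*ˡ xs p f)) (sym (distribˡ _ _ _))

  -- For polynomials over the rationals this is definitionally the expectation in the definition of
  -- `S`.
  𝔼 : ∀ {n} → (Vec Side n → Carrier) → Carrier
  𝔼 {n} f = Σ (placements n) (λ ω → ⟦ ℙ ω ⟧ * f ω)

  𝔼-cong : ∀ n {f g : Vec Side n → Carrier} → (∀ ω → f ω ≈ g ω) → 𝔼 f ≈ 𝔼 g
  𝔼-cong n f≈g = Σ-cong (placements n) (λ ω → *-congˡ (f≈g ω))

  𝔼-*ˡ : ∀ n p (f : Vec Side n → Carrier) → 𝔼 (λ ω → p * f ω) ≈ p * 𝔼 f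
  𝔼-*ˡ n p f =
    trans (Σ-cong (placements n) (λ ω → x∙yz≈y∙xz _ _ _)) (Σ-*ˡ (placements n) p _)

  -- Conditioning on the first flip, which decides the side of the highest card.
  𝔼-∷ : ∀ n (f : Vec Side (suc n) → Carrier) →
    𝔼 f ≈ ⟦ ½ ⟧ * (𝔼 (λ ω → f (top ∷ ω)) + 𝔼 (λ ω → f (bottom ∷ ω)))
  𝔼-∷ n f = begin
    𝔼 f
      ≈⟨ Σ-++ (map (top ∷_) (placements n)) (map (bottom ∷_) (placements n)) _ ⟩
    Σ (map (top ∷_) (placements n)) _ + Σ (map (bottom ∷_) (placements n)) _
      ≈⟨ +-cong (branch top) (branch bottom) ⟩
    ⟦ ½ ⟧ * 𝔼 (λ ω → f (top ∷ ω)) + ⟦ ½ ⟧ * 𝔼 (λ ω → f (bottom ∷ ω))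
      ≈⟨ distribˡ _ _ _ ⟨
    ⟦ ½ ⟧ * (𝔼 (λ ω → f (top ∷ ω)) + 𝔼 (λ ω → f (bottom ∷ ω))) ∎
    where
    branch : ∀ s → Σ (map (s ∷_) (placements n)) (λ ω → ⟦ ℙ ω ⟧ * f ω)
                 ≈ ⟦ ½ ⟧ * 𝔼 (λ ω → f (s ∷ ω))
    branch s = begin
      Σ (map (s ∷_) (placements n)) (λ ω → ⟦ ℙ ω ⟧ * f ω)
        ≡⟨ ≡.cong (foldr _+_ 0#) (map-∘ (placements n)) ⟨
      Σ (placements n) (λ ω → ⟦ ½ ℚ.* ℙ ω ⟧ * f (s ∷ ω))
        ≈⟨ Σ-cong (placements n) (λ ω → trans (*-congʳ (*-homo ½ (ℙ ω))) (*-assoc _ _ _)) ⟩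
      Σ (placements n) (λ ω → ⟦ ½ ⟧ * (⟦ ℙ ω ⟧ * f (s ∷ ω)))
        ≈⟨ Σ-*ˡ (placements n) ⟦ ½ ⟧ _ ⟩
      ⟦ ½ ⟧ * 𝔼 (λ ω → f (s ∷ ω)) ∎

  module _ (x : Carrier) where

    -- The coefficient of z^n in the series a (for `top`) or b (for `bottom`), with `x` in place of
    -- v.
    𝔼-nonAscents : Side → ℕ → Carrier
    𝔼-nonAscents s n = 𝔼 {n} (λ ω → x ^ nonAscents (s ∷ ω))

    -- Both outcomes of the first flip give the same expectation, so one flip disappears and the
    -- highest card counts as top.
    𝔼-X : ∀ n → 𝔼 (λ ω → x ^ X (suc n) ω) ≈ 𝔼-nonAscents top n
    𝔼-X n = begin
      𝔼 (λ ω → x ^ X (suc n) ω) ≈⟨ 𝔼-∷ n _ ⟩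
      ⟦ ½ ⟧ * (_ + _)           ≈⟨ *-congˡ (+-cong (branch top) (branch bottom)) ⟩
      ⟦ ½ ⟧ * (p + p)           ≈⟨ distribˡ _ _ _ ⟩
      ⟦ ½ ⟧ * p + ⟦ ½ ⟧ * p     ≈⟨ distribʳ _ _ _ ⟨
      (⟦ ½ ⟧ + ⟦ ½ ⟧) * p       ≈⟨ *-congʳ (trans (sym (+-homo ½ ½)) 1-homo) ⟩
      1# * p                    ≈⟨ *-identityˡ p ⟩
      p                         ∎
      where
      p = 𝔼-nonAscents top n
      branch : ∀ s → 𝔼 (λ ω → x ^ X (suc n) (s ∷ ω)) ≈ p
      branch s = 𝔼-cong n (λ ω → reflexive (≡.cong (x ^_) (X≡nonAscents s ω)))

    -- After the fictitious card 0 marked top, either mark of card 1 is a non-ascent.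
    𝔼-nonAscents-0 : ∀ s → 𝔼-nonAscents s 0 ≈ x
    𝔼-nonAscents-0 s = trans (+-identityʳ _) (trans (*-congʳ 1-homo)
      (trans (*-identityˡ _) (first s)))
      where
      first : ∀ s → x ^ nonAscents (s ∷ []) ≈ x
      first top    = *-identityʳ x
      first bottom = *-identityʳ x

    -- Conditioning on the mark next below the prescribed one: a bottom there is the only case
    -- without a factor `x`.
    𝔼-nonAscents-top : ∀ n → 𝔼-nonAscents top (suc n)
      ≈ ⟦ ½ ⟧ * (x * 𝔼-nonAscents top n + 𝔼-nonAscents bottom n)
    𝔼-nonAscents-top n = trans (𝔼-∷ n _) (*-congˡ (+-congʳ (𝔼-*ˡ n x _)))

    𝔼-nonAscents-bottom : ∀ n → 𝔼-nonAscents bottom (suc n)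
      ≈ ⟦ ½ ⟧ * (x * 𝔼-nonAscents top n + x * 𝔼-nonAscents bottom n)
    𝔼-nonAscents-bottom n = trans (𝔼-∷ n _) (*-congˡ (+-cong (𝔼-*ˡ n x _) (𝔼-*ˡ n x _)))

  -- Generating functions of the expectations.

  open PowerSeries rawRing using (Series; const; indeterminate)
  open PowerSeriesProperties R
    using (seriesRing; const-mul; indeterminate-mul-zero; indeterminate-mul-suc)
  private
    module Z = CommutativeRing seriesRing

  const-morphism : ℚ.+-*-rawRing -Raw-AlmostCommutative⟶ fromCommutativeRing seriesRing
  const-morphism = record
    { ⟦_⟧    = λ p → const ⟦ p ⟧
    ; +-homo = λ { p q zero → +-homo p q ; p q (suc n) → sym (+-identityˡ 0#) }
    ; *-homo = λ { p q zero    → trans (*-homo p q) (sym (const-mul ⟦ p ⟧ (const ⟦ q ⟧) 0))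
                 ; p q (suc n) → sym (trans (const-mul ⟦ p ⟧ (const ⟦ q ⟧) (suc n)) (zeroʳ _)) }
    ; -‿homo = λ { p zero → -‿homo p ; p (suc n) → sym -0#≈0# }
    ; 0-homo = λ { zero → 0-homo ; (suc n) → refl }
    ; 1-homo = λ { zero → 1-homo ; (suc n) → refl }
    }

  module _ (x : Carrier) where

    private
      v h z A B : Series
      v = const x
      h = const ⟦ ½ ⟧
      z = indeterminate
      A = 𝔼-nonAscents x top
      B = 𝔼-nonAscents x bottom

    -- Multiplication by `z` shifts coefficients, so a recursion with initial value `x` becomes a
    -- functional equation.
    unroll : ∀ f g → f 0 ≈ x → (∀ n → f (suc n) ≈ ⟦ ½ ⟧ * g n) →
      f Z.≈ v Z.+ z Z.* (h Z.* g)
    unroll f g f₀ f₊ zero = begin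
      f 0                          ≈⟨ f₀ ⟩
      x                            ≈⟨ +-identityʳ x ⟨
      x + 0#                       ≈⟨ +-congˡ (indeterminate-mul-zero (h Z.* g)) ⟨
      x + (z Z.* (h Z.* g)) 0      ∎
    unroll f g f₀ f₊ (suc n) = begin
      f (suc n)                        ≈⟨ f₊ n ⟩
      ⟦ ½ ⟧ * g n                      ≈⟨ const-mul ⟦ ½ ⟧ g n ⟨
      (h Z.* g) n                      ≈⟨ indeterminate-mul-suc (h Z.* g) n ⟨
      (z Z.* (h Z.* g)) (suc n)        ≈⟨ +-identityˡ _ ⟨
      0# + (z Z.* (h Z.* g)) (suc n)   ∎

    A-equation : A Z.≈ v Z.+ z Z.* (h Z.* (v Z.* A Z.+ B))
    A-equation = unroll A _ (𝔼-nonAscents-0 x top) λ n →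
      trans (𝔼-nonAscents-top x n) (*-congˡ (+-congʳ (sym (const-mul x A n))))

    B-equation : B Z.≈ v Z.+ z Z.* (h Z.* (v Z.* A Z.+ v Z.* B))
    B-equation = unroll B _ (𝔼-nonAscents-0 x bottom) λ n →
      trans (𝔼-nonAscents-bottom x n)
            (*-congˡ (+-cong (sym (const-mul x A n)) (sym (const-mul x B n))))

    open RationalAlgebra seriesRing const-morphism
      using (linear-system; numerator′; denominator′)

    generating-function : ∀ G → G 0 ≈ 0# → (∀ n → G (suc n) ≈ 𝔼 (λ ω → x ^ X (suc n) ω)) →
      G Z.* denominator′ z v Z.≈ numerator′ z v
    generating-function G G₀ G₊ =
      Z.trans (Z.*-congʳ G≈zA) (linear-system z v A-equation B-equation)
      where
      -- The factor `z` accounts for the highest card: `suc n` cards leave `n` random marks.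
      G≈zA : G Z.≈ z Z.* A
      G≈zA zero    = trans G₀ (sym (indeterminate-mul-zero A))
      G≈zA (suc n) = trans (trans (G₊ n) (𝔼-X x n)) (sym (indeterminate-mul-suc A n))

-- Specialization to polynomials in v with rational coefficients.

open import Defs

ℚ[v]-ring : CommutativeRing 0ℓ 0ℓ
ℚ[v]-ring = PolynomialProperties.polyRing ℚ.+-*-commutativeRing

ℚ[v]-const : ℚ.+-*-rawRing -Raw-AlmostCommutative⟶ fromCommutativeRing ℚ[v]-ring
ℚ[v]-const = record
  { ⟦_⟧    = ℚ[v].const
  ; +-homo = λ p q i → ≡.refl
  ; *-homo = λ { p q zero → ≡.sym (ℚ.+-identityʳ (p ℚ.* q)) ; p q (suc i) → ≡.refl }
  ; -‿homo = λ p i → ≡.refl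
  ; 0-homo = λ { zero → ≡.refl ; (suc i) → ≡.refl }
  ; 1-homo = λ i → ≡.refl
  }

open PowerSeriesProperties ℚ[v]-ring using (seriesRing; mul-reciprocal)
open Expectation ℚ[v]-ring ℚ[v]-const using (const-morphism; generating-function)
open RationalAlgebra seriesRing const-morphism
  using (numerator′; denominator′; ≈-quotient; fractions-equal)
open PowerSeries ℚ[v].rawRing using (reciprocal)

lemma3 : (S ≈ (z * v + (half * (z ^ 2 * v)) / (1# - half * (z * v)))
    / (1# - half * (z * v) - (half * z) / (1# - half * (z * v)) + half * z))
    ×
    ((z * v + (half * (z ^ 2 * v)) / (1# - half * (z * v)))
    / (1# - half * (z * v) - (half * z) / (1# - half * (z * v)) + half * z)
    ≈ (2 · (z * v) * (2 · 1# + (1# - v) * z))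
    / (4 · 1# - 4 · (v * z) + (v ^ 2 - v) * z ^ 2))
-- Elimination yields the second fraction, so the first identity is reached through it.
lemma3 = (λ n i → ≡.trans (S≈ n i) (≡.sym (fractions≈ n i))) , fractions≈
  where
  i₁ = reciprocal _ inv₁
  i₂ = reciprocal _ inv₂
  i₃ = reciprocal _ inv₃
  fractions≈ = fractions-equal z v {i₁} {i₂} {i₃}
    (mul-reciprocal _ inv₁) (mul-reciprocal _ inv₂) (mul-reciprocal _ inv₃)
  S≈ = ≈-quotient {S} {numerator′ z v} {denominator′ z v} {i₃} (mul-reciprocal _ inv₃)
    (generating-function ℚ[v].indeterminate S (λ _ → ≡.refl) (λ _ _ → ≡.refl))
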